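{- Let $G$ be a finite simple graph of order $n$. If $Z(D_t(G,x))=\{ -2,0\}$, then $\kappa(G)\le 2$.
   Context: For a finite simple graph $G=(V,E)$, a set $D\subseteq V$ is a total dominating set if every vertex of $V$ is adjacent to some vertex of $D$. $d_t(G,i)$ is the number of total dominating sets of $G$ of cardinality $i$, and $D_t(G,x)=\sum_i d_t(G,i)x^i$ is the total domination polynomial. $Z(D_t(G,x))$ denotes the set of distinct (complex) roots of $D_t(G,x)$. The (vertex) connectivity $\kappa(G)$ of a connected non-complete graph $G$ is the smallest integer $k$ such that there is a set $V'\subseteq V$ of $k$ vertices with $G-V'$ not connected; by the usual conventions $\kappa(G)=0$ if $G$ is disconnected and $\kappa(K_n)=n-1$. -}

module Defs where

open import Algebra.Apartness.Bundles using (HeytingField; HeytingCommutativeRing)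
open import Algebra.Bundles using (CommutativeRing; RawSemiring; Semiring)
import Algebra.Definitions.RawSemiring as SemiringOperations
open import Data.Fin.Base using (Fin; toℕ; fromℕ)
open import Data.Fin.Properties using (any?; all?; _≟_)
open import Data.Fin.Subset
  using (Subset; inside; outside; _∈_; _∉_; ⊤; ⁅_⁆; ∁; _∪_; _-_; _⊂_; ∣_∣)
open import Data.Fin.Subset.Induction using (⊂-wellFounded; Acc; acc)
open import Data.Fin.Subset.Properties
  using (_∈?_; anySubset?; x∈⁅x⁆; x∈⁅y⁆⇒x≡y; x∈p⇒p-x⊂p; x∈p∧x≢y⇒x∈p-y; p─q⊆p;
         x∈p∪q⁻; x∈p∪q⁺; x∈∁p⇒x∉p; x∉∁p⇒x∈p; x∈p⇒x∉∁p; x∉p⇒x∈∁p)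
open import Data.List.Base using (List; []; _∷_; _++_; map; filter; length)
open import Data.Nat.Base as ℕ using (ℕ; zero; suc; _∸_; _≤_; _<_)
open import Data.Nat.Induction using (<-wellFounded)
import Data.Nat.Properties as ℕₚ
open import Data.Product.Base using (∃; _×_; _,_; proj₁; proj₂)
open import Data.Sum.Base using (_⊎_; inj₁; inj₂)
import Data.Vec.Base as Vec
open import Data.Vec.Functional using (Vector)
open import Level using (Level; 0ℓ)
open import Relation.Binary.Construct.Closure.ReflexiveTransitive
  using (Star; ε; _◅_; gmap)
open import Relation.Binary.Core using (Rel)
open import Relation.Binary.Definitions using (Decidable; Symmetric; Irreflexive)
open import Relation.Binary.PropositionalEquality
  using (_≡_; _≢_; refl; sym; subst)
open import Relation.Nullary using (¬_; Dec; yes; no; contradiction)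
open import Relation.Nullary.Decidable
  using (_×-dec_; _→-dec_; ¬?; map′; decidable-stable)
open import Relation.Unary using (Pred)

private
  variable
    c ℓ₁ ℓ₂ : Level
    n : ℕ

record Graph (n : ℕ) : Set₁ where
  infix 4 _~_ _~?_
  field
    _~_      : Rel (Fin n) 0ℓ
    _~?_     : Decidable _~_
    ~-sym    : Symmetric _~_
    ~-irrefl : Irreflexive _≡_ _~_

------------------------------------------------------------------------
-- Total domination

TotalDominating : Graph n → Subset n → Set
TotalDominating G D = ∀ v → ∃ λ u → u ∈ D × v ~ u
  where open Graph G

totalDominating? : (G : Graph n) (D : Subset n) → Dec (TotalDominating G D)
totalDominating? G D = all? λ v → any? λ u → (u ∈? D) ×-dec (v ~? u)
  where open Graph G

-- Each subset of Fin n occurs exactly once in this list.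
subsets : ∀ n → List (Subset n)
subsets zero    = Vec.[] ∷ []
subsets (suc n) =
  map (inside Vec.∷_) (subsets n) ++ map (outside Vec.∷_) (subsets n)

dₜ : Graph n → ℕ → ℕ
dₜ {n} G i =
  length (filter (λ D → totalDominating? G D ×-dec (∣ D ∣ ℕₚ.≟ i)) (subsets n))

-- Polynomials are coefficient vectors, with the coefficient of xⁱ at index i.
-- Degree n suffices here, as no subset of Fin n has more than n elements.
Dₜ : Graph n → Vector ℕ (suc n)
Dₜ G i = dₜ G (toℕ i)

------------------------------------------------------------------------
-- Roots

-- The field of complex numbers is replaced by an arbitrary algebraically closed
-- field of characteristic zero.
module _ (K : HeytingField c ℓ₁ ℓ₂) where

  open HeytingField K

  private
    K-rawSemiring : RawSemiring c ℓ₁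
    K-rawSemiring =
      Semiring.rawSemiring (CommutativeRing.semiring
        (HeytingCommutativeRing.commutativeRing heytingCommutativeRing))

  -- _·ℕ_ is multiplication by a natural number; `m ·ℕ 1#` is the image of m.
  open SemiringOperations K-rawSemiring public
    using (sum; _^_) renaming (_×_ to _·ℕ_)

  eval : ∀ {m} → Vector Carrier m → Carrier → Carrier
  eval p z = sum λ i → p i * z ^ toℕ i

  Z : ∀ {m} → Vector ℕ m → Pred Carrier ℓ₁
  Z p z = eval (λ i → p i ·ℕ 1#) z ≈ 0#

  CharacteristicZero : Set ℓ₁
  CharacteristicZero = ∀ m → ¬ (suc m ·ℕ 1# ≈ 0#)

  -- Here p has degree exactly d + 1: its leading coefficient is apart from 0#.
  AlgebraicallyClosed : Set _
  AlgebraicallyClosed = ∀ d (p : Vector Carrier (suc (suc d))) →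
    p (fromℕ (suc d)) # 0# → ∃ λ z → eval p z ≈ 0#

------------------------------------------------------------------------
-- Connectivity

module _ (G : Graph n) where

  open Graph G

  InducedEdge : Subset n → Rel (Fin n) 0ℓ
  InducedEdge A u v = u ~ v × u ∈ A × v ∈ A

  -- The subgraph induced by A is connected; a graph without vertices counts
  -- as connected, which does not affect the vertex connectivity.
  ConnectedOn : Subset n → Set
  ConnectedOn A = ∀ u v → u ∈ A → v ∈ A → Star (InducedEdge A) u v

  Connected : Set
  Connected = ConnectedOn ⊤

  Separating : Subset n → Set
  Separating S = ¬ ConnectedOn (∁ S)

  Complete : Set
  Complete = ∀ u v → u ≢ v → u ~ v

  data IsConnectivity : ℕ → Set where
    disconnected : ¬ Connected → IsConnectivity 0
    complete     : Complete → IsConnectivity (n ∸ 1)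
    minimumCut   : Connected → ¬ Complete →
                   (S : Subset n) → Separating S →
                   (∀ T → Separating T → ∣ S ∣ ≤ ∣ T ∣) →
                   IsConnectivity ∣ S ∣

  private

    weaken : ∀ {A u x y} → InducedEdge (A - u) x y → InducedEdge A x y
    weaken {A} {u} (e , p , q) = e , p─q⊆p A ⁅ u ⁆ p , p─q⊆p A ⁅ u ⁆ q

    FirstStep : Subset n → Rel (Fin n) 0ℓ
    FirstStep A u v = ∃ λ w → u ~ w × w ∈ A × Star (InducedEdge (A - u)) w v

    -- Either the walk avoids u, or we cut it at its last visit to u.
    lastVisit : ∀ {A u v x} → u ≢ v → Star (InducedEdge A) x v →
                (x ≢ u × Star (InducedEdge (A - u)) x v) ⊎ FirstStep A u v
    lastVisit u≢v ε = inj₁ ((λ eq → u≢v (sym eq)) , ε)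
    lastVisit {u = u} {x = x} u≢v ((e , x∈A , y∈A) ◅ walk)
      with lastVisit u≢v walk
    ... | inj₂ step = inj₂ step
    ... | inj₁ (y≢u , walk′) with x ≟ u
    ...   | yes refl = inj₂ (_ , e , y∈A , walk′)
    ...   | no x≢u   = inj₁
      (x≢u , (e , x∈p∧x≢y⇒x∈p-y x∈A x≢u , x∈p∧x≢y⇒x∈p-y y∈A y≢u) ◅ walk′)

    reachable? : ∀ A → Acc _⊂_ A → Decidable (Star (InducedEdge A))
    reachable? A (acc rec) u v with u ≟ v
    ... | yes refl = yes ε
    ... | no u≢v with u ∈? A
    ...   | no u∉A  = no λ { ε → u≢v refl ; ((_ , u∈A , _) ◅ _) → u∉A u∈A }
    ...   | yes u∈A = map′ from to (any? λ w → (u ~? w) ×-dec (w ∈? A) ×-dec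
                        reachable? (A - u) (rec (x∈p⇒p-x⊂p u∈A)) w v)
      where
      from : FirstStep A u v → Star (InducedEdge A) u v
      from (w , e , w∈A , walk) = (e , u∈A , w∈A) ◅ gmap (λ x → x) weaken walk

      to : Star (InducedEdge A) u v → FirstStep A u v
      to walk with lastVisit u≢v walk
      ... | inj₁ (u≢u , _) = contradiction refl u≢u
      ... | inj₂ step      = step

    connectedOn? : ∀ A → Dec (ConnectedOn A)
    connectedOn? A = all? λ u → all? λ v → (u ∈? A) →-dec ((v ∈? A) →-dec
      reachable? A (⊂-wellFounded A) u v)

    minimise : ∀ S → Acc _<_ ∣ S ∣ → Separating S →
               ∃ λ S′ → Separating S′ × (∀ T → Separating T → ∣ S′ ∣ ≤ ∣ T ∣)
    minimise S (acc rec) sep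
      with anySubset? (λ T → ¬? (connectedOn? (∁ T)) ×-dec (∣ T ∣ ℕₚ.<? ∣ S ∣))
    ... | yes (T , sepT , T<S) = minimise T (rec T<S) sepT
    ... | no none = S , sep , λ T sepT → ℕₚ.≮⇒≥ λ T<S → none (T , sepT , T<S)

    separate : ∀ {u v} → u ≢ v → ¬ (u ~ v) → Separating (∁ (⁅ u ⁆ ∪ ⁅ v ⁆))
    separate {u} {v} u≢v u≁v conn = noWalk (conn u v
        (x∉p⇒x∈∁p (x∈p⇒x∉∁p (x∈p∪q⁺ (inj₁ (x∈⁅x⁆ u)))))
        (x∉p⇒x∈∁p (x∈p⇒x∉∁p (x∈p∪q⁺ (inj₂ (x∈⁅x⁆ v))))))
      where
      noWalk : ¬ Star (InducedEdge (∁ (∁ (⁅ u ⁆ ∪ ⁅ v ⁆)))) u v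
      noWalk ε = u≢v refl
      noWalk ((e , _ , w∈) ◅ _)
        with x∈p∪q⁻ ⁅ u ⁆ ⁅ v ⁆ (x∉∁p⇒x∈p (x∈∁p⇒x∉p w∈))
      ... | inj₁ w∈u = ~-irrefl (sym (x∈⁅y⁆⇒x≡y u w∈u)) e
      ... | inj₂ w∈v = u≁v (subst (u ~_) (x∈⁅y⁆⇒x≡y v w∈v) e)

  connectivity : ∃ IsConnectivity
  connectivity with connectedOn? ⊤
  ... | no ¬conn = 0 , disconnected ¬conn
  ... | yes conn
    with any? (λ u → any? λ v → ¬? (u ≟ v) ×-dec ¬? (u ~? v))
  ...   | no none = n ∸ 1 , complete λ u v u≢v →
    decidable-stable (u ~? v) λ u≁v → none (u , v , u≢v , u≁v)
  ...   | yes (u , v , u≢v , u≁v)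
    with minimise _ (<-wellFounded _) (separate u≢v u≁v)
  ...     | S , sep , least =
    ∣ S ∣ , minimumCut conn (λ comp → u≁v (comp u v u≢v)) S sep least

  κ : ℕ
  κ = proj₁ connectivity

{-# OPTIONS --safe #-}

-- Let t k be the number of total dominating sets whose complement has k
-- elements, so that t k is the coefficient of x^(n-k).  If every vertex had at
-- least three neighbours, then every set with a complement of at most two
-- elements would be total dominating, so t k = n C k for k ≤ 2.  But every root
-- satisfies r² = -2r; summing over the roots with multiplicity gives
-- t₁² - 2t₂ = 2t₁, that is n² - n(n-1) = 2n, which forces n = 0.  Hence some
-- vertex has at most two neighbours, and removing them bounds κ.
module Submission where

open import Defs
open import Algebra.Apartness.Bundles using (HeytingField; HeytingCommutativeRing)
open import Algebra.Bundles using (CommutativeRing)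
import Algebra.Apartness.Properties.HeytingCommutativeRing as HeytingProperties
import Algebra.Properties.Ring as RingProperties
import Algebra.Properties.Semiring.Mult as SemiringMult
import Algebra.Properties.Semiring.Sum as SemiringSum
import Algebra.Solver.Ring.NaturalCoefficients.Default as NaturalSolver
open import Data.Bool.Base using (true; false)
open import Data.Fin.Base using (Fin; zero; suc; toℕ; fromℕ)
open import Data.Fin.Properties using (any?; _≟_; toℕ-fromℕ; toℕ≤pred[n])
open import Data.Fin.Subset
  using (Subset; inside; outside; _∈_; _⊆_; ⁅_⁆; ∁; ∣_∣)
open import Data.Fin.Subset.Properties
  using (_∈?_; ∣p∣≤n; ∣⁅x⁆∣≡1; p⊆q⇒∣p∣≤∣q∣; ∣∁p∣≡n∸∣p∣;
         x∈⁅x⁆; x∈⁅y⁆⇒x≡y; x∈∁p⇒x∉p; x∉p⇒x∈∁p)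
open import Data.List.Base using ([]; _∷_; _++_; map; filter; length)
open import Data.List.Properties using (filter-≐; filter-++; filter-none; length-++)
open import Data.List.Relation.Unary.All using (universal)
open import Data.Nat.Base as ℕ using (ℕ; zero; suc; _∸_; _≤_; _<_; z≤n; s≤s)
open import Data.Nat.Combinatorics using (_C_; nC1≡n; nCk+nC[k+1]≡[n+1]C[k+1])
import Data.Nat.Properties as ℕₚ
open import Data.Nat.Tactic.RingSolver using (solve-∀)
open import Data.Product.Base using (_,_; proj₂)
open import Data.Sum.Base using (_⊎_; inj₁; inj₂; [_,_]′)
import Data.Vec.Base as Vec
open import Data.Vec.Properties using (lookup∘tabulate; []=⇒lookup; lookup⇒[]=)
open import Level using (0ℓ)
open import Relation.Binary.Construct.Closure.ReflexiveTransitive using (ε; _◅_)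
import Relation.Binary.PropositionalEquality as ≡
open ≡ using (_≡_; _≢_)
open import Relation.Nullary using (¬_; does; yes; no; contradiction)
open import Relation.Nullary.Decidable using (_×-dec_; ¬?; dec-true)
open import Relation.Unary using (Pred; _≐_; Decidable)

private
  variable
    n : ℕ

-- Monic polynomials over a field

module _ {c ℓ₁ ℓ₂} (K : HeytingField c ℓ₁ ℓ₂) where

  open HeytingField K
  open CommutativeRing
    (HeytingCommutativeRing.commutativeRing heytingCommutativeRing)
    using (semiring; ring; commutativeSemiring)
  open HeytingProperties heytingCommutativeRing using (1#0; #-congʳ)
  open RingProperties ring using (+-cancelʳ)
  open SemiringSum semiring using (*-distribˡ-sum; sum-cong-≋)
  open NaturalSolver commutativeSemiring using (solve; con; _:=_; _:+_; _:*_)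
  open import Relation.Binary.Reasoning.Setoid setoid

  -- A polynomial of degree d is given by the stream of its coefficients from
  -- the leading one downwards; a k is the coefficient of x^(d-k).  As a
  -- function of d, horner a z is also the coefficient stream of the quotient
  -- by x - z.
  horner : (ℕ → Carrier) → Carrier → ℕ → Carrier
  horner a z zero    = a 0
  horner a z (suc d) = a (suc d) + z * horner a z d

  -- `eval` indexes from the constant term upwards, hence the reversal. Splitting off the constant
  -- term and drawing one factor `z` out of the other terms is one Horner step.
  eval-horner : ∀ a z d → eval K (λ (i : Fin (suc d)) → a (d ∸ toℕ i)) z ≈ horner a z d
  eval-horner a z zero = trans (+-identityʳ _) (*-identityʳ _)
  eval-horner a z (suc d) = +-cong (*-identityʳ _) (begin
    sum K {suc d} (λ i → a (d ∸ toℕ i) * (z * z ^′ toℕ i))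
      ≈⟨ sum-cong-≋ {suc d} (λ i → swap (a (d ∸ toℕ i)) z (z ^′ toℕ i)) ⟩
    sum K {suc d} (λ i → z * (a (d ∸ toℕ i) * z ^′ toℕ i))
      ≈⟨ *-distribˡ-sum z (λ (i : Fin (suc d)) → a (d ∸ toℕ i) * z ^′ toℕ i) ⟨
    z * eval K (λ (i : Fin (suc d)) → a (d ∸ toℕ i)) z
      ≈⟨ *-congˡ (eval-horner a z d) ⟩
    z * horner a z d ∎)
    where
    _^′_ = _^_ K
    swap : ∀ x y w → x * (y * w) ≈ y * (x * w)
    swap = solve 3 (λ x y w → x :* (y :* w) := y :* (x :* w)) refl

  -- p x = p z + (x - z) q x, with both sides moved so that no subtraction occurs.
  horner-divide : ∀ a z x d →
    horner a x (suc d) + z * horner (horner a z) x d ≈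
    horner a z (suc d) + x * horner (horner a z) x d
  horner-divide a z x zero =
    solve 4 (λ a₀ a₁ z x → (a₁ :+ x :* a₀) :+ z :* a₀ := (a₁ :+ z :* a₀) :+ x :* a₀)
      refl (a 0) (a 1) z x
  horner-divide a z x (suc d) = begin
    (a₂ + x * p) + z * (s + x * q)
      ≈⟨ solve 6 (λ a₂ x p z s q → (a₂ :+ x :* p) :+ z :* (s :+ x :* q) :=
                   (a₂ :+ z :* s) :+ x :* (p :+ z :* q)) refl a₂ x p z s q ⟩
    (a₂ + z * s) + x * (p + z * q)
      ≈⟨ +-congˡ (*-congˡ (horner-divide a z x d)) ⟩
    (a₂ + z * s) + x * (s + x * q) ∎
    where
    a₂ = a (suc (suc d))
    p  = horner a x (suc d)
    s  = horner a z (suc d)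
    q  = horner (horner a z) x d

  quotient-root : ∀ a z x d → horner a z (suc d) ≈ 0# →
    horner (horner a z) x d ≈ 0# → horner a x (suc d) ≈ 0#
  quotient-root a z x d az≈0 qx≈0 = begin
    horner a x (suc d)         ≈⟨ trans (+-congˡ (vanish z)) (+-identityʳ _) ⟨
    horner a x (suc d) + z * q ≈⟨ horner-divide a z x d ⟩
    horner a z (suc d) + x * q ≈⟨ +-cong az≈0 (vanish x) ⟩
    0# + 0#                    ≈⟨ +-identityˡ 0# ⟩
    0#                         ∎
    where
    q = horner (horner a z) x d
    vanish : ∀ y → y * q ≈ 0#
    vanish y = trans (*-congˡ qx≈0) (zeroʳ y)

  -- The entry of the quotient stream at `suc d` is the remainder, zero at a root; every later entry
  -- is a vanishing coefficient plus `z` times the entry before.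
  quotient-vanishes : ∀ a z d → (∀ k → suc d < k → a k ≈ 0#) →
    horner a z (suc d) ≈ 0# → ∀ k → d < k → horner a z k ≈ 0#
  quotient-vanishes a z d a≈0 az≈0 (suc k) (s≤s d≤k) with ℕₚ.m≤n⇒m<n∨m≡n d≤k
  ... | inj₂ ≡.refl = az≈0
  ... | inj₁ d<k = begin
    a (suc k) + z * horner a z k
      ≈⟨ +-cong (a≈0 (suc k) (s≤s d<k))
                (*-congˡ (quotient-vanishes a z d a≈0 az≈0 k d<k)) ⟩
    0# + z * 0# ≈⟨ trans (+-identityˡ _) (zeroʳ z) ⟩
    0#          ∎

  -- The sum of the roots is - a 1 and the sum of their squares is
  -- a 1 * a 1 - (a 2 + a 2).
  squareSum-roots : AlgebraicallyClosed K → ∀ d a → a 0 ≈ 1# →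
    (∀ k → d < k → a k ≈ 0#) →
    (∀ z → horner a z d ≈ 0# → z * z + (z + z) ≈ 0#) →
    a 1 * a 1 ≈ (a 2 + a 2) + (a 1 + a 1)
  -- In degree zero both `a 1` and `a 2` lie beyond the degree.
  squareSum-roots closed zero a monic a≈0 roots = begin
    a 1 * a 1                 ≈⟨ trans (*-congʳ a₁≈0) (zeroˡ _) ⟩
    0#                        ≈⟨ trans (+-cong (+-identityˡ 0#) (+-identityˡ 0#)) (+-identityˡ 0#) ⟨
    (0# + 0#) + (0# + 0#)     ≈⟨ +-cong (+-cong a₂≈0 a₂≈0) (+-cong a₁≈0 a₁≈0) ⟨
    (a 2 + a 2) + (a 1 + a 1) ∎
    where
    a₁≈0 = a≈0 1 (s≤s z≤n)
    a₂≈0 = a≈0 2 (s≤s z≤n)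
  squareSum-roots closed (suc d) a monic a≈0 roots
    with closed d (λ i → a (suc d ∸ toℕ i)) (#-congʳ (sym leading) 1#0)
    where
    leading : a (suc d ∸ toℕ (fromℕ (suc d))) ≈ 1#
    leading rewrite toℕ-fromℕ d | ℕₚ.n∸n≡0 d = monic
  -- Induction on the quotient by x - z, whose first coefficients are `s₁` and `s₂`. Adding `w`
  -- completes `a₁ * a₁` to the square of `s₁`; on the other side it leaves the excess
  -- `z * z + (z + z)`, which is zero because `z` is a root.
  ... | z , eval≈0 = +-cancelʳ w _ _ (begin
    a₁ * a₁ + w
      ≈⟨ solve 2 (λ a₁ z → a₁ :* a₁ :+ ((z :* a₁ :+ z :* a₁) :+ z :* z) :=
                    (a₁ :+ z) :* (a₁ :+ z)) refl a₁ z ⟩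
    (a₁ + z) * (a₁ + z)
      ≈⟨ *-cong s₁≈ s₁≈ ⟨
    s₁ * s₁
      ≈⟨ squareSum-roots closed d (horner a z) monic
           (quotient-vanishes a z d a≈0 az≈0)
           (λ x qx≈0 → roots x (quotient-root a z x d az≈0 qx≈0)) ⟩
    (s₂ + s₂) + (s₁ + s₁)
      ≈⟨ +-cong (+-cong s₂≈ s₂≈) (+-cong s₁≈ s₁≈) ⟩
    ((a₂ + z * (a₁ + z)) + (a₂ + z * (a₁ + z))) + ((a₁ + z) + (a₁ + z))
      ≈⟨ solve 3 (λ a₁ a₂ z →
           ((a₂ :+ z :* (a₁ :+ z)) :+ (a₂ :+ z :* (a₁ :+ z))) :+ ((a₁ :+ z) :+ (a₁ :+ z)) :=
           (z :* z :+ (z :+ z)) :+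
           (((a₂ :+ a₂) :+ (a₁ :+ a₁)) :+ ((z :* a₁ :+ z :* a₁) :+ z :* z))) refl a₁ a₂ z ⟩
    (z * z + (z + z)) + (((a₂ + a₂) + (a₁ + a₁)) + w)
      ≈⟨ trans (+-congʳ (roots z az≈0)) (+-identityˡ _) ⟩
    ((a₂ + a₂) + (a₁ + a₁)) + w ∎)
    where
    a₁ = a 1
    a₂ = a 2
    s₁ = horner a z 1
    s₂ = horner a z 2
    w  = (z * a₁ + z * a₁) + z * z
    az≈0 : horner a z (suc d) ≈ 0#
    az≈0 = trans (sym (eval-horner a z (suc d))) eval≈0
    s₁≈ : s₁ ≈ a₁ + z
    s₁≈ = +-congˡ (trans (*-congˡ monic) (*-identityʳ z))
    s₂≈ : s₂ ≈ a₂ + z * (a₁ + z)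
    s₂≈ = +-congˡ (*-congˡ s₁≈)

  -2∨0⇒z²+2z≈0 : ∀ {z} → z ≈ - (1# + 1#) ⊎ z ≈ 0# → z * z + (z + z) ≈ 0#
  -2∨0⇒z²+2z≈0 {z} z≈ = begin
    z * z + (z + z)    ≈⟨ solve 1 (λ z → z :* z :+ (z :+ z) := z :* (z :+ (con 1 :+ con 1))) refl z ⟩
    z * (z + (1# + 1#)) ≈⟨ [ (λ z≈-2 → trans (*-congˡ (trans (+-congʳ z≈-2) (-‿inverseˡ _))) (zeroʳ z))
                           , (λ z≈0 → trans (*-congʳ z≈0) (zeroˡ _)) ]′ z≈ ⟩
    0# ∎

-- Twice `n C 2` is n(n-1), here with the subtraction moved across; the induction step is Pascal's
-- rule.
n*n≡2*nC2+n : ∀ n → n ℕ.* n ≡ (n C 2 ℕ.+ n C 2) ℕ.+ n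
n*n≡2*nC2+n zero    = ≡.refl
n*n≡2*nC2+n (suc n) = begin
  suc n ℕ.* suc n                              ≡⟨ lemma₁ n ⟩
  n ℕ.* n ℕ.+ (n ℕ.+ suc n)                    ≡⟨ ≡.cong (ℕ._+ (n ℕ.+ suc n)) (n*n≡2*nC2+n n) ⟩
  ((n C 2 ℕ.+ n C 2) ℕ.+ n) ℕ.+ (n ℕ.+ suc n)  ≡⟨ lemma₂ (n C 2) n ⟩
  ((n ℕ.+ n C 2) ℕ.+ (n ℕ.+ n C 2)) ℕ.+ suc n  ≡⟨ ≡.cong (λ m → (m ℕ.+ m) ℕ.+ suc n) pascal ⟩
  (suc n C 2 ℕ.+ suc n C 2) ℕ.+ suc n          ∎
  where
  open ≡.≡-Reasoning
  lemma₁ : ∀ n → suc n ℕ.* suc n ≡ n ℕ.* n ℕ.+ (n ℕ.+ suc n)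
  lemma₁ = solve-∀
  lemma₂ : ∀ b n → ((b ℕ.+ b) ℕ.+ n) ℕ.+ (n ℕ.+ suc n) ≡ ((n ℕ.+ b) ℕ.+ (n ℕ.+ b)) ℕ.+ suc n
  lemma₂ = solve-∀
  pascal : n ℕ.+ n C 2 ≡ suc n C 2
  pascal = ≡.trans (≡.cong (ℕ._+ n C 2) (≡.sym (nC1≡n n))) (nCk+nC[k+1]≡[n+1]C[k+1] n 1)

-- Counting total dominating sets

length-filter-map : ∀ {A B : Set} {P : Pred B 0ℓ} (P? : Decidable P) (f : A → B) xs →
  length (filter P? (map f xs)) ≡ length (filter (λ x → P? (f x)) xs)
length-filter-map P? f []       = ≡.refl
length-filter-map P? f (x ∷ xs) with does (P? (f x))
... | true = ≡.cong suc (length-filter-map P? f xs)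
... | false = length-filter-map P? f xs

-- The first element adds to the complement exactly when it is outside, so splitting on it gives
-- Pascal's rule.
#∁≡C : ∀ n k → length (filter (λ D → ∣ ∁ D ∣ ℕₚ.≟ k) (subsets n)) ≡ n C k
#∁≡C zero    zero    = ≡.refl
#∁≡C zero    (suc k) = ≡.refl
#∁≡C (suc n) k = begin
  length (filter P? (map (inside Vec.∷_) Ds ++ map (outside Vec.∷_) Ds))
    ≡⟨ ≡.cong length (filter-++ P? (map (inside Vec.∷_) Ds) _) ⟩
  length (filter P? (map (inside Vec.∷_) Ds) ++ filter P? (map (outside Vec.∷_) Ds))
    ≡⟨ length-++ (filter P? (map (inside Vec.∷_) Ds)) ⟩
  length (filter P? (map (inside Vec.∷_) Ds)) ℕ.+ length (filter P? (map (outside Vec.∷_) Ds))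
    ≡⟨ ≡.cong₂ ℕ._+_ (length-filter-map P? (inside Vec.∷_) Ds)
                     (length-filter-map P? (outside Vec.∷_) Ds) ⟩
  length (filter (λ D → ∣ ∁ D ∣ ℕₚ.≟ k) Ds) ℕ.+ length (filter (λ D → suc ∣ ∁ D ∣ ℕₚ.≟ k) Ds)
    ≡⟨ ≡.cong₂ ℕ._+_ (#∁≡C n k) (omitted k) ⟩
  n C k ℕ.+ previous k
    ≡⟨ pascal k ⟩
  suc n C k ∎
  where
  open ≡.≡-Reasoning
  Ds = subsets n
  P? = λ (D : Subset (suc n)) → ∣ ∁ D ∣ ℕₚ.≟ k

  -- This is n C (k-1), with 0 at `k = 0`: a set that omits the first element has a nonempty
  -- complement. Truncated subtraction would give `n C 0`, which is 1.
  previous : ℕ → ℕ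
  previous zero    = 0
  previous (suc k) = n C k

  omitted : ∀ k → length (filter (λ D → suc ∣ ∁ D ∣ ℕₚ.≟ k) Ds) ≡ previous k
  omitted zero    = ≡.cong length
    (filter-none (λ D → suc ∣ ∁ D ∣ ℕₚ.≟ 0) (universal (λ _ ()) Ds))
  omitted (suc k) = ≡.trans
    (≡.cong length (filter-≐ (λ D → suc ∣ ∁ D ∣ ℕₚ.≟ suc k) (λ D → ∣ ∁ D ∣ ℕₚ.≟ k)
      (ℕₚ.suc-injective , ≡.cong suc) Ds))
    (#∁≡C n k)

  pascal : ∀ k → n C k ℕ.+ previous k ≡ suc n C k
  pascal zero    = ≡.refl
  pascal (suc k) = ≡.trans (ℕₚ.+-comm (n C suc k) (n C k)) (nCk+nC[k+1]≡[n+1]C[k+1] n k)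

module _ (G : Graph n) where

  open Graph G

  dₜ∁ : ℕ → ℕ
  dₜ∁ k = length (filter (λ D → totalDominating? G D ×-dec (∣ ∁ D ∣ ℕₚ.≟ k)) (subsets n))

  -- On sizes up to `n` the map `n ∸_` is injective, so fixing the size of a set or that of its
  -- complement selects the same sets.
  dₜ≡dₜ∁ : ∀ {i} → i ≤ n → dₜ G i ≡ dₜ∁ (n ∸ i)
  dₜ≡dₜ∁ {i} i≤n = ≡.cong length (filter-≐ _ _
    ( (λ {D} (td , ∣D∣≡i) → td , ≡.trans (∣∁p∣≡n∸∣p∣ D) (≡.cong (n ∸_) ∣D∣≡i))
    , (λ {D} (td , ∣∁D∣≡) → td ,
        ℕₚ.∸-cancelˡ-≡ (∣p∣≤n D) i≤n (≡.trans (≡.sym (∣∁p∣≡n∸∣p∣ D)) ∣∁D∣≡)))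
    (subsets n))

  dₜ∁-vanishes : ∀ k → n < k → dₜ∁ k ≡ 0
  dₜ∁-vanishes k n<k = ≡.cong length (filter-none _ (universal
    (λ D (_ , ∣∁D∣≡k) → ℕₚ.<⇒≱ n<k (≡.subst (_≤ n) ∣∁D∣≡k (∣p∣≤n (∁ D)))) (subsets n)))

  neighbours : Fin n → Subset n
  neighbours v = Vec.tabulate λ u → does (v ~? u)

  ~⇒∈neighbours : ∀ {u v} → v ~ u → u ∈ neighbours v
  ~⇒∈neighbours {u} {v} v~u = lookup⇒[]= u _
    (≡.trans (lookup∘tabulate _ u) (dec-true (v ~? u) v~u))

  ∈neighbours⇒~ : ∀ {u v} → u ∈ neighbours v → v ~ u
  ∈neighbours⇒~ {u} {v} u∈ with v ~? u | ≡.trans (≡.sym (lookup∘tabulate _ u)) ([]=⇒lookup u∈)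
  ... | yes v~u | _ = v~u
  ... | no  _   | ()

  -- A vertex with no neighbour in `D` has its whole neighbourhood inside `∁ D`, which is too small
  -- to hold it.
  smallComplement⇒totalDominating : ∀ D → (∀ v → ∣ ∁ D ∣ < ∣ neighbours v ∣) → TotalDominating G D
  smallComplement⇒totalDominating D small v with any? (λ u → (u ∈? D) ×-dec (v ~? u))
  ... | yes dominated = dominated
  ... | no undominated = contradiction (p⊆q⇒∣p∣≤∣q∣ neighbours⊆∁D) (ℕₚ.<⇒≱ (small v))
    where
    neighbours⊆∁D : neighbours v ⊆ ∁ D
    neighbours⊆∁D u∈ = x∉p⇒x∈∁p λ u∈D → undominated (_ , u∈D , ∈neighbours⇒~ u∈)

  dₜ∁≡C : ∀ k → (∀ v → k < ∣ neighbours v ∣) → dₜ∁ k ≡ n C k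
  dₜ∁≡C k k<deg = ≡.trans
    (≡.cong length (filter-≐ _ (λ D → ∣ ∁ D ∣ ℕₚ.≟ k)
      ( proj₂
      , (λ {D} ∣∁D∣≡k →
          smallComplement⇒totalDominating D
            (λ v → ≡.subst (_< ∣ neighbours v ∣) (≡.sym ∣∁D∣≡k) (k<deg v))
          , ∣∁D∣≡k))
      (subsets n)))
    (#∁≡C n k)

-- Connectivity and degrees

  -- Otherwise `∁ S` is empty, and the empty graph counts as connected.
  separating⇒∣S∣<n : ∀ S → Separating G S → ∣ S ∣ < n
  separating⇒∣S∣<n S sep = ℕₚ.≰⇒> λ n≤∣S∣ → sep λ u v u∈∁S _ →
    contradiction
      (≡.subst₂ _≤_ (∣⁅x⁆∣≡1 u) (≡.trans (∣∁p∣≡n∸∣p∣ S) (ℕₚ.m≤n⇒m∸n≡0 n≤∣S∣))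
        (p⊆q⇒∣p∣≤∣q∣ (λ x∈ → ≡.subst (_∈ ∁ S) (≡.sym (x∈⁅y⁆⇒x≡y u x∈)) u∈∁S)))
      λ()

  isConnectivity⇒≤n∸1 : ∀ {k} → IsConnectivity G k → k ≤ n ∸ 1
  isConnectivity⇒≤n∸1 (disconnected _)         = z≤n
  isConnectivity⇒≤n∸1 (complete _)             = ℕₚ.≤-refl
  isConnectivity⇒≤n∸1 (minimumCut _ _ S sep _) = ℕₚ.∸-monoˡ-≤ 1 (separating⇒∣S∣<n S sep)

  -- Removing its neighbourhood isolates `v`: the first edge of a walk to `w` would end at a removed
  -- vertex.
  neighbours-separating : ∀ {v w} → v ≢ w → ¬ (v ~ w) → Separating G (neighbours v)
  neighbours-separating {v} {w} v≢w v≁w conn with conn v w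
    (x∉p⇒x∈∁p λ v∈ → ~-irrefl ≡.refl (∈neighbours⇒~ v∈))
    (x∉p⇒x∈∁p λ w∈ → v≁w (∈neighbours⇒~ w∈))
  ... | ε = v≢w ≡.refl
  ... | (v~x , _ , x∈∁) ◅ _ = x∈∁p⇒x∉p x∈∁ (~⇒∈neighbours v~x)

  -- If some other vertex is not adjacent to `v`, the neighbourhood of `v` separates the two.
  -- Otherwise the degree of `v` is at least `n ∸ 1`, which bounds the connectivity of any graph.
  isConnectivity⇒≤degree : ∀ {k} → IsConnectivity G k → ∀ v → k ≤ ∣ neighbours v ∣
  isConnectivity⇒≤degree isκ v with any? (λ w → ¬? (v ≟ w) ×-dec ¬? (v ~? w))
  isConnectivity⇒≤degree (disconnected _) v | yes _ = z≤n
  isConnectivity⇒≤degree (complete comp) v | yes (w , v≢w , v≁w) =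
    contradiction (comp v w v≢w) v≁w
  isConnectivity⇒≤degree (minimumCut _ _ S _ least) v | yes (w , v≢w , v≁w) =
    least (neighbours v) (neighbours-separating v≢w v≁w)
  isConnectivity⇒≤degree isκ v | no allAdjacent =
    ℕₚ.≤-trans (isConnectivity⇒≤n∸1 isκ) (ℕₚ.m≤n+o⇒m∸n≤o n 1 n≤1+degree)
    where
    ∁neighbours⊆⁅v⁆ : ∁ (neighbours v) ⊆ ⁅ v ⁆
    ∁neighbours⊆⁅v⁆ {w} w∈∁ with v ≟ w
    ... | yes ≡.refl = x∈⁅x⁆ v
    ... | no v≢w = contradiction (_ , v≢w , λ v~w → x∈∁p⇒x∉p w∈∁ (~⇒∈neighbours v~w)) allAdjacent

    n≤1+degree : n ≤ 1 ℕ.+ ∣ neighbours v ∣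
    n≤1+degree = ≡.subst (n ≤_) (ℕₚ.+-comm ∣ neighbours v ∣ 1)
      (ℕₚ.≤-trans (ℕₚ.m≤n+m∸n n ∣ neighbours v ∣) (ℕₚ.+-monoʳ-≤ ∣ neighbours v ∣
        (≡.subst₂ _≤_ (∣∁p∣≡n∸∣p∣ (neighbours v)) (∣⁅x⁆∣≡1 v) (p⊆q⇒∣p∣≤∣q∣ ∁neighbours⊆⁅v⁆))))

-- Comparing the root identity with the binomial counts

module _ {c ℓ₁ ℓ₂} (K : HeytingField c ℓ₁ ℓ₂) where

  open HeytingField K
  open CommutativeRing
    (HeytingCommutativeRing.commutativeRing heytingCommutativeRing)
    using (semiring; ring)
  open RingProperties ring using (+-cancelˡ)
  open SemiringMult semiring using (×-homo-+; ×1-homo-*; ×-congˡ)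
  open SemiringSum semiring using (sum-cong-≋)
  open import Relation.Binary.Reasoning.Setoid setoid

  minDegree>2⇒n≡0 : CharacteristicZero K → AlgebraicallyClosed K → (G : Graph n) →
    (∀ v → 2 < ∣ neighbours G v ∣) →
    (∀ {z} → Z K (Dₜ G) z → z ≈ - (1# + 1#) ⊎ z ≈ 0#) → n ≡ 0
  -- Cancelling the common part of both sides leaves that the image of `n` in the field is zero;
  -- `isZero` lifts this to ℕ by characteristic zero.
  minDegree>2⇒n≡0 {n} char0 closed G deg>2 roots = isZero n (+-cancelˡ (⟦ n C 2 ⟧ + ⟦ n C 2 ⟧ + ⟦ n ⟧) _ _ (begin
    ⟦ n C 2 ⟧ + ⟦ n C 2 ⟧ + ⟦ n ⟧ + ⟦ n ⟧
      ≈⟨ +-assoc _ _ _ ⟩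
    (⟦ n C 2 ⟧ + ⟦ n C 2 ⟧) + (⟦ n ⟧ + ⟦ n ⟧)
      ≈⟨ +-cong (+-cong a₂≈ a₂≈) (+-cong a₁≈ a₁≈) ⟨
    (a 2 + a 2) + (a 1 + a 1)
      ≈⟨ squareSum-roots K closed n a
           -- The polynomial is monic: the full vertex set is the one set with empty complement, and
           -- it is total dominating as all degrees are positive.
           (trans (×-congˡ (dₜ∁≡C G 0 λ v → ℕₚ.<-trans (s≤s z≤n) (deg>2 v))) (+-identityʳ 1#))
           (λ k n<k → ×-congˡ (dₜ∁-vanishes G k n<k))
           (λ z az≈0 → -2∨0⇒z²+2z≈0 K (roots (horner-root az≈0))) ⟨
    a 1 * a 1
      ≈⟨ *-cong a₁≈ a₁≈ ⟩
    ⟦ n ⟧ * ⟦ n ⟧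
      ≈⟨ ×1-homo-* n n ⟨
    ⟦ n ℕ.* n ⟧
      ≈⟨ ×-congˡ (n*n≡2*nC2+n n) ⟩
    ⟦ n C 2 ℕ.+ n C 2 ℕ.+ n ⟧
      ≈⟨ trans (×-homo-+ 1# (n C 2 ℕ.+ n C 2) n) (+-congʳ (×-homo-+ 1# (n C 2) (n C 2))) ⟩
    ⟦ n C 2 ⟧ + ⟦ n C 2 ⟧ + ⟦ n ⟧
      ≈⟨ +-identityʳ _ ⟨
    ⟦ n C 2 ⟧ + ⟦ n C 2 ⟧ + ⟦ n ⟧ + 0# ∎))
    where
    ⟦_⟧ : ℕ → Carrier
    ⟦ m ⟧ = _·ℕ_ K m 1#

    a : ℕ → Carrier
    a k = ⟦ dₜ∁ G k ⟧

    a₁≈ : a 1 ≈ ⟦ n ⟧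
    a₁≈ = ×-congˡ (≡.trans (dₜ∁≡C G 1 λ v → ℕₚ.<-trans (s≤s (s≤s z≤n)) (deg>2 v)) (nC1≡n n))

    a₂≈ : a 2 ≈ ⟦ n C 2 ⟧
    a₂≈ = ×-congˡ (dₜ∁≡C G 2 deg>2)

    horner-root : ∀ {z} → horner K a z n ≈ 0# → Z K (Dₜ G) z
    horner-root {z} az≈0 = trans (trans
      (sum-cong-≋ {suc n} λ i → *-congʳ {_^_ K z (toℕ i)} (×-congˡ {1#} (dₜ≡dₜ∁ G (toℕ≤pred[n] i))))
      (eval-horner K a z n)) az≈0

    isZero : ∀ m → ⟦ m ⟧ ≈ 0# → m ≡ 0
    isZero zero    _   = ≡.refl
    isZero (suc m) m≈0 = contradiction m≈0 (char0 m)

theorem4p4 : ∀ {c ℓ₁ ℓ₂} (K : HeytingField c ℓ₁ ℓ₂) →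
    CharacteristicZero K → AlgebraicallyClosed K →
    let open HeytingField K in
    ∀ (n : ℕ) (G : Graph n) →
    Z K (Dₜ G) ≐ (λ z → z ≈ - (1# + 1#) ⊎ z ≈ 0#) →
    κ G ≤ 2
theorem4p4 K char0 closed n G (roots , _) with any? (λ v → ∣ neighbours G v ∣ ℕₚ.≤? 2)
... | yes (v , deg≤2) = ℕₚ.≤-trans (isConnectivity⇒≤degree G (proj₂ (connectivity G)) v) deg≤2
-- All degrees exceed 2, so `n` is 0, and the general bound `n ∸ 1` is then 0 as well.
... | no  deg≰2 = ℕₚ.≤-trans (isConnectivity⇒≤n∸1 G (proj₂ (connectivity G)))
  (≡.subst (λ m → m ∸ 1 ≤ 2)
    (≡.sym (minDegree>2⇒n≡0 K char0 closed G (λ v → ℕₚ.≰⇒> λ deg≤2 → deg≰2 (v , deg≤2)) roots))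
    z≤n)
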